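{- Let $G$ be a twin-free graph and let $H$ be a graph (such that $G\Box H$ has an identifying code). Then $\gamma^{\rm ID}(G\Box H) \ge \gamma^{\rm ID}(G)\,\rho_2(H)$.
   Context: All graphs are finite, simple and undirected. $N[x]$ denotes the closed neighborhood of $x$. Two distinct vertices $x,y$ are twins if $N[x]=N[y]$; a graph is twin-free if it has no twins. An identifying code (ID code) of a graph $F$ is a set $C\subseteq V(F)$ such that $N[x]\cap C\neq\emptyset$ for every vertex $x$ and $N[x]\cap C\neq N[y]\cap C$ for all distinct vertices $x,y$. A graph has an ID code if and only if it is twin-free, and $\gamma^{\rm ID}(F)$ denotes the minimum cardinality of an ID code of $F$. A 2-packing of a graph $H$ is a set of vertices any two distinct members of which are at distance at least $3$ (vertices in different components count as being at distance $\infty$); $\rho_2(H)$ is the largest cardinality of a 2-packing of $H$. $G\Box H$ denotes the Cartesian product. -}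

module Defs where

open import Data.Bool.Properties using () renaming (_≟_ to _≟ᵇ_)
open import Data.Fin using (Fin; remQuot)
open import Data.Fin.Properties using (_≟_; any?; all?)
open import Data.Fin.Subset using (Subset; ⊤; ⊥; _∩_; ∣_∣; _∈_; Nonempty)
open import Data.Fin.Subset.Properties
  using (anySubset?; nonempty?; _∈?_; ∈⊤; ∉⊥; ∩-identityʳ; ∣p∣≤n)
open import Data.Nat using (ℕ; zero; suc; _≤_; _<_; _∸_; _*_; z≤n; s≤s; _<?_)
open import Data.Nat.Induction using (<-wellFounded)
open import Data.Nat.Properties using (≮⇒≥; ∸-cancelʳ-≤)
open import Data.Product using (∃; ∃-syntax; _×_; _,_; proj₁; proj₂)
open import Data.Sum using (_⊎_; inj₁; inj₂)
open import Data.Vec using (tabulate)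
open import Data.Vec.Properties using (≡-dec; lookup⇒[]=; lookup∘tabulate)
open import Induction.WellFounded using (Acc; acc)
open import Level using (0ℓ)
open import Relation.Binary.Core using (Rel)
open import Relation.Binary.Definitions using (Decidable; Symmetric)
open import Relation.Binary.PropositionalEquality
  using (_≡_; _≢_; refl; sym; trans; subst)
open import Relation.Nullary using (Dec; yes; no; does; ¬_; ¬?; contradiction)
open import Relation.Nullary.Decidable
  using (_×-dec_; _⊎-dec_; _→-dec_; map′; dec-true)
import Relation.Unary as U

-- Finite simple undirected graphs on n vertices.
record Graph (n : ℕ) : Set₁ where
  field
    Adj      : Rel (Fin n) 0ℓ
    adj?     : Decidable Adj
    adj-sym  : Symmetric Adj
    loopless : ∀ x → ¬ Adj x x

  N[_] : Fin n → Subset n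
  N[ x ] = tabulate (λ y → does ((y ≟ x) ⊎-dec adj? x y))

open Graph

-- The vertex (g , h) of G □ H is encoded as  combine g h : Fin (m * n),
-- and  remQuot n  recovers the pair.
infixr 7 _□_
_□_ : ∀ {m n} → Graph m → Graph n → Graph (m * n)
_□_ {m} {n} G H = record
  { Adj      = λ x y → A (remQuot n x) (remQuot n y)
  ; adj?     = λ x y → A? (remQuot n x) (remQuot n y)
  ; adj-sym  = λ { (inj₁ (e , a)) → inj₁ (sym e , adj-sym H a)
                 ; (inj₂ (a , e)) → inj₂ (adj-sym G a , sym e) }
  ; loopless = λ { x (inj₁ (_ , a)) → loopless H _ a
                 ; x (inj₂ (a , _)) → loopless G _ a }
  }
  where
  A : Rel (Fin m × Fin n) 0ℓ
  A (g , h) (g′ , h′) = (g ≡ g′ × Adj H h h′) ⊎ (Adj G g g′ × h ≡ h′)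

  A? : Decidable A
  A? (g , h) (g′ , h′) =
    ((g ≟ g′) ×-dec adj? H h h′) ⊎-dec (adj? G g g′ ×-dec (h ≟ h′))

Twins : ∀ {n} → Graph n → Rel (Fin n) 0ℓ
Twins G x y = x ≢ y × N[_] G x ≡ N[_] G y

TwinFree : ∀ {n} → Graph n → Set
TwinFree G = ∀ x y → ¬ Twins G x y

IsIDCode : ∀ {n} → Graph n → U.Pred (Subset n) 0ℓ
IsIDCode G C =
    (∀ x → Nonempty (N[_] G x ∩ C))
  × (∀ x y → x ≢ y → N[_] G x ∩ C ≢ N[_] G y ∩ C)

HasIDCode : ∀ {n} → Graph n → Set
HasIDCode G = ∃[ C ] IsIDCode G C

data Walk {n} (G : Graph n) : Fin n → Fin n → ℕ → Set where
  []  : ∀ {x} → Walk G x x 0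
  _∷_ : ∀ {x y z k} → Adj G x y → Walk G y z k → Walk G x z (suc k)

-- The distance from x to y is the least length of a walk between them, and ∞
-- if there is none; in the latter case DistanceAtLeast holds for every d.
DistanceAtLeast : ∀ {n} → Graph n → ℕ → Rel (Fin n) 0ℓ
DistanceAtLeast G d x y = ∀ k → Walk G x y k → d ≤ k

Is2Packing : ∀ {n} → Graph n → U.Pred (Subset n) 0ℓ
Is2Packing H S = ∀ x y → x ∈ S → y ∈ S → x ≢ y → DistanceAtLeast H 3 x y

module _ {n} (P : U.Pred (Subset n) 0ℓ) where

  IsMinCard : ℕ → Set
  IsMinCard k = (∃[ S ] (P S × ∣ S ∣ ≡ k)) × (∀ T → P T → k ≤ ∣ T ∣)

  IsMaxCard : ℕ → Set
  IsMaxCard k = (∃[ S ] (P S × ∣ S ∣ ≡ k)) × (∀ T → P T → ∣ T ∣ ≤ k)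

module _ {n} {P : U.Pred (Subset n) 0ℓ} (P? : U.Decidable P) where

  argmin : (f : Subset n → ℕ) → ∃ P → ∃[ S ] (P S × (∀ T → P T → f S ≤ f T))
  argmin f (S₀ , p₀) = go S₀ p₀ (<-wellFounded (f S₀))
    where
    go : ∀ S → P S → Acc _<_ (f S) → ∃[ S′ ] (P S′ × (∀ T → P T → f S′ ≤ f T))
    go S p (acc rs) with anySubset? (λ T → P? T ×-dec (f T <? f S))
    ... | yes (T , q , T<S) = go T q (rs T<S)
    ... | no none = S , p , λ T q → ≮⇒≥ (λ T<S → none (T , q , T<S))

  minCard : ∃ P → ∃ (IsMinCard P)
  minCard e with argmin ∣_∣ e
  ... | S , p , min = ∣ S ∣ , (S , p , refl) , min

  maxCard : ∃ P → ∃ (IsMaxCard P)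
  maxCard e with argmin (λ S → n ∸ ∣ S ∣) e
  ... | S , p , min =
    ∣ S ∣ , (S , p , refl) , λ T q → ∸-cancelʳ-≤ (∣p∣≤n T) (min T q)

isIDCode? : ∀ {n} (G : Graph n) → U.Decidable (IsIDCode G)
isIDCode? G C =
  all? (λ x → nonempty? (N[_] G x ∩ C))
  ×-dec
  all? (λ x → all? (λ y →
    ¬? (x ≟ y) →-dec ¬? (≡-dec _≟ᵇ_ (N[_] G x ∩ C) (N[_] G y ∩ C))))

walk? : ∀ {n} (G : Graph n) x y k → Dec (Walk G x y k)
walk? G x y zero = map′ (λ { refl → [] }) (λ { [] → refl }) (x ≟ y)
walk? G x z (suc k) = map′
  (λ { (_ , a , w) → a ∷ w }) (λ { (a ∷ w) → _ , a , w })
  (any? (λ y → adj? G x y ×-dec walk? G y z k))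

distanceAtLeast? : ∀ {n} (G : Graph n) d → Decidable (DistanceAtLeast G d)
distanceAtLeast? G zero x y = yes (λ _ _ → z≤n)
distanceAtLeast? G (suc d) x y with walk? G x y 0
... | yes w = no (λ far → contradiction (far 0 w) λ ())
... | no ¬w = map′ to from
    (all? (λ z → adj? G x z →-dec distanceAtLeast? G d z y))
  where
  to : (∀ z → Adj G x z → DistanceAtLeast G d z y) →
       DistanceAtLeast G (suc d) x y
  to f zero    w       = contradiction w ¬w
  to f (suc k) (a ∷ w) = s≤s (f _ a k w)

  from : DistanceAtLeast G (suc d) x y →
         ∀ z → Adj G x z → DistanceAtLeast G d z y
  from f z a k w with f (suc k) (a ∷ w)
  ... | s≤s le = le

is2Packing? : ∀ {n} (H : Graph n) → U.Decidable (Is2Packing H)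
is2Packing? H S = all? (λ x → all? (λ y →
  (x ∈? S) →-dec ((y ∈? S) →-dec
    (¬? (x ≟ y) →-dec distanceAtLeast? H 3 x y))))

twinFree⇒hasIDCode : ∀ {n} (G : Graph n) → TwinFree G → HasIDCode G
twinFree⇒hasIDCode G tf = ⊤ , dominating , separating
  where
  N∩⊤ : ∀ x → N[_] G x ∩ ⊤ ≡ N[_] G x
  N∩⊤ x = ∩-identityʳ (N[_] G x)

  dominating : ∀ x → Nonempty (N[_] G x ∩ ⊤)
  dominating x = x , subst (x ∈_) (sym (N∩⊤ x))
    (lookup⇒[]= x _ (trans (lookup∘tabulate _ x)
      (dec-true ((x ≟ x) ⊎-dec adj? G x x) (inj₁ refl))))

  separating : ∀ x y → x ≢ y → N[_] G x ∩ ⊤ ≢ N[_] G y ∩ ⊤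
  separating x y x≢y eq =
    tf x y (x≢y , trans (sym (N∩⊤ x)) (trans eq (N∩⊤ y)))

∅-2packing : ∀ {n} (H : Graph n) → Is2Packing H ⊥
∅-2packing H x y x∈∅ = contradiction x∈∅ ∉⊥

-- γᴵᴰ is defined only for graphs that have an identifying code; the value does
-- not depend on which code is supplied as evidence.
γᴵᴰ : ∀ {n} (G : Graph n) → HasIDCode G → ℕ
γᴵᴰ G c = proj₁ (minCard (isIDCode? G) c)

γᴵᴰ-isMinCard : ∀ {n} (G : Graph n) (c : HasIDCode G) →
                IsMinCard (IsIDCode G) (γᴵᴰ G c)
γᴵᴰ-isMinCard G c = proj₂ (minCard (isIDCode? G) c)

ρ₂ : ∀ {n} → Graph n → ℕ
ρ₂ H = proj₁ (maxCard (is2Packing? H) (⊥ , ∅-2packing H))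

ρ₂-isMaxCard : ∀ {n} (H : Graph n) → IsMaxCard (Is2Packing H) (ρ₂ H)
ρ₂-isMaxCard H = proj₂ (maxCard (is2Packing? H) (⊥ , ∅-2packing H))

{-# OPTIONS --safe #-}

-- If h and h′ are distinct members of a 2-packing S of H, the slices G □ N[h]
-- and G □ N[h′] are disjoint, so it suffices that every slice contains at least
-- γᴵᴰ(G) vertices of an identifying code of G □ H.  Among the code vertices in
-- the slice of h, let A be the G-coordinates of those in the layer of h and D
-- the G-coordinates of the others.  The code sees (x , h) with x ∉ D only
-- through A, so A dominates and separates the vertices outside D.  As G is
-- twin-free, each vertex of D can be taken care of at the cost of one additional
-- vertex, as in Bondy's theorem on induced subsets; this turns A into an
-- identifying code of G with at most |A| + |D| vertices.
module Submission where

open import Defs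
open import Data.Bool using (true; false; _∧_)
open import Data.Bool.Properties using (∧-identityʳ) renaming (_≟_ to _≟ᵇ_)
open import Data.Fin using (Fin; zero; suc; combine; remQuot)
open import Data.Fin.Properties
  using (_≟_; any?; suc-injective; remQuot-combine; combine-remQuot; combine-injective)
open import Data.Fin.Subset
  using (Subset; inside; outside; ⊥; ⁅_⁆; _∪_; _∩_; ∣_∣; _⊆_; _∈_; _∉_; Nonempty)
open import Data.Fin.Subset.Properties
  using (∣⊥∣≡0; ∣⁅x⁆∣≡1; x∈⁅x⁆; p⊆p∪q; q⊆p∪q; x∈p∩q⁺; x∈p∩q⁻; ⊆-antisym; ∉⊥)
  renaming (_∈?_ to _∈ˢ?_)
open import Data.List using (List; []; _∷_; length; map; filter)
open import Data.List.Membership.DecPropositional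
  using () renaming (_∈?_ to mem?)
open import Data.List.Membership.Propositional
  using () renaming (_∈_ to _∈ˡ_; _∉_ to _∉ˡ_)
open import Data.List.Membership.Propositional.Properties
  using (∈-map⁺; ∈-map⁻; ∈-filter⁺)
open import Data.List.Properties using (length-map)
import Data.List.Relation.Unary.All as All
open import Data.List.Relation.Unary.All using (All; []; _∷_)
open import Data.List.Relation.Unary.AllPairs using ([]; _∷_)
open import Data.List.Relation.Unary.Any using (here; there)
open import Data.List.Relation.Unary.Unique.Propositional using (Unique)
import Data.List.Relation.Unary.Unique.Propositional.Properties as Unique
open import Data.Nat using (ℕ; suc; _+_; _*_; _≤_; _≥_; z≤n; s≤s)
open import Data.Nat.Properties
  using ( ≤-reflexive; ≤-trans; +-mono-≤; +-suc; *-zeroʳ; *-suc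
        ; +-identityʳ; m≤n⇒m≤1+n; module ≤-Reasoning)
open import Data.Product using (∃-syntax; _×_; _,_; proj₁; proj₂)
open import Data.Sum using (_⊎_; inj₁; inj₂)
open import Data.Vec using ([]; _∷_; lookup; here; there)
open import Data.Vec.Properties
  using ( []=⇒lookup; lookup⇒[]=; lookup∘tabulate; lookup-zipWith; lookup-replicate
        ; tabulate∘lookup; tabulate-cong)
open import Function using (_∘_)
open import Function.Definitions using (Injective)
open import Level using (0ℓ)
open import Relation.Binary.Core using (Rel)
open import Relation.Binary.PropositionalEquality
open import Relation.Nullary using (Dec; yes; no; does; ¬_; ¬?; contradiction)
open import Relation.Nullary.Decidable
  using (_×-dec_; _⊎-dec_; dec-true; dec-false; decidable-stable)
import Relation.Unary as U

open Graph

-- Lists and finite sets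

∉-∷ : ∀ {X : Set} {x y : X} {xs} → x ≢ y → y ∉ˡ xs → y ∉ˡ x ∷ xs
∉-∷ x≢y y∉ (here y≡x) = x≢y (sym y≡x)
∉-∷ x≢y y∉ (there y∈) = y∉ y∈

length-filter-¬filter : ∀ {X : Set} {P : U.Pred X 0ℓ} (P? : U.Decidable P) xs →
  length (filter P? xs) + length (filter (¬? ∘ P?) xs) ≡ length xs
length-filter-¬filter P? [] = refl
length-filter-¬filter P? (x ∷ xs) with ih ← length-filter-¬filter P? xs | does (P? x)
... | true  = cong suc ih
... | false = trans (+-suc _ _) (cong suc ih)

-- Induction on `is`: filtering `xs` by `Q? i` leaves a list that covers `Q i`, so it has at least
-- `k` entries, and by disjointness the other part of `xs` still covers the later predicates. Asking
-- the bound of every covering list avoids counting `Q i` itself.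
disjoint-covers⇒*≤length :
  ∀ {I X : Set} {Q : I → U.Pred X 0ℓ} (Q? : ∀ i → U.Decidable (Q i)) {k is xs} →
  Unique is →
  (∀ {i j x} → i ∈ˡ is → j ∈ˡ is → i ≢ j → Q i x → ¬ Q j x) →
  (∀ {i} ys → (∀ {x} → Q i x → x ∈ˡ ys) → k ≤ length ys) →
  (∀ {i x} → i ∈ˡ is → Q i x → x ∈ˡ xs) →
  k * length is ≤ length xs
disjoint-covers⇒*≤length Q? {k} {[]} [] _ _ _ =
  ≤-trans (≤-reflexive (*-zeroʳ k)) z≤n
disjoint-covers⇒*≤length Q? {k} {i ∷ is} {xs} (i∉is ∷ u) disj big cov = begin
  k * suc (length is)
    ≡⟨ *-suc k (length is) ⟩
  k + k * length is
    ≤⟨ +-mono-≤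
         (big _ λ q → ∈-filter⁺ (Q? i) (cov (here refl) q) q)
         (disjoint-covers⇒*≤length Q? u
           (λ p q → disj (there p) (there q))
           big
           (λ p q → ∈-filter⁺ (¬? ∘ Q? i) (cov (there p) q)
             (disj (there p) (here refl) (All.lookup i∉is p ∘ sym) q))) ⟩
  length (filter (Q? i) xs) + length (filter (¬? ∘ Q? i) xs)
    ≡⟨ length-filter-¬filter (Q? i) xs ⟩
  length xs ∎
  where open ≤-Reasoning

elements : ∀ {n} → Subset n → List (Fin n)
elements []            = []
elements (inside  ∷ p) = zero ∷ map suc (elements p)
elements (outside ∷ p) = map suc (elements p)

length-elements : ∀ {n} (p : Subset n) → length (elements p) ≡ ∣ p ∣
length-elements []            = refl
length-elements (inside  ∷ p) =
  cong suc (trans (length-map suc (elements p)) (length-elements p))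
length-elements (outside ∷ p) = trans (length-map suc (elements p)) (length-elements p)

∈-elements⁺ : ∀ {n} {p : Subset n} {x} → x ∈ p → x ∈ˡ elements p
∈-elements⁺ {p = inside  ∷ p} here        = here refl
∈-elements⁺ {p = inside  ∷ p} (there x∈p) = there (∈-map⁺ suc (∈-elements⁺ x∈p))
∈-elements⁺ {p = outside ∷ p} (there x∈p) = ∈-map⁺ suc (∈-elements⁺ x∈p)

∈-elements⁻ : ∀ {n} (p : Subset n) {x} → x ∈ˡ elements p → x ∈ p
∈-elements⁻ (inside  ∷ p) (here refl) = here
∈-elements⁻ (inside  ∷ p) (there x∈) with ∈-map⁻ suc x∈
... | _ , y∈ , refl = there (∈-elements⁻ p y∈)
∈-elements⁻ (outside ∷ p) x∈ with ∈-map⁻ suc x∈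
... | _ , y∈ , refl = there (∈-elements⁻ p y∈)

elements-unique : ∀ {n} (p : Subset n) → Unique (elements p)
elements-unique []            = []
elements-unique (inside  ∷ p) =
  All.tabulate (λ x∈ 0≡x → zero∉map-suc (subst (_∈ˡ _) (sym 0≡x) x∈)) ∷
  Unique.map⁺ suc-injective (elements-unique p)
  where
  zero∉map-suc : ∀ {n} {xs : List (Fin n)} → zero ∉ˡ map suc xs
  zero∉map-suc z∈ with ∈-map⁻ suc z∈
  ... | _ , _ , ()
elements-unique (outside ∷ p) = Unique.map⁺ suc-injective (elements-unique p)

∣p∪q∣≤∣p∣+∣q∣ : ∀ {n} (p q : Subset n) → ∣ p ∪ q ∣ ≤ ∣ p ∣ + ∣ q ∣
∣p∪q∣≤∣p∣+∣q∣ []            []            = z≤n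
∣p∪q∣≤∣p∣+∣q∣ (inside  ∷ p) (inside  ∷ q) = s≤s
  (≤-trans (m≤n⇒m≤1+n (∣p∪q∣≤∣p∣+∣q∣ p q)) (≤-reflexive (sym (+-suc ∣ p ∣ ∣ q ∣))))
∣p∪q∣≤∣p∣+∣q∣ (inside  ∷ p) (outside ∷ q) = s≤s (∣p∪q∣≤∣p∣+∣q∣ p q)
∣p∪q∣≤∣p∣+∣q∣ (outside ∷ p) (inside  ∷ q) =
  ≤-trans (s≤s (∣p∪q∣≤∣p∣+∣q∣ p q)) (≤-reflexive (sym (+-suc ∣ p ∣ ∣ q ∣)))
∣p∪q∣≤∣p∣+∣q∣ (outside ∷ p) (outside ∷ q) = ∣p∪q∣≤∣p∣+∣q∣ p q

fromList : ∀ {n} → List (Fin n) → Subset n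
fromList []       = ⊥
fromList (x ∷ xs) = ⁅ x ⁆ ∪ fromList xs

-- Only an inequality, since `xs` may repeat entries.
∣fromList∣≤length : ∀ {n} (xs : List (Fin n)) → ∣ fromList xs ∣ ≤ length xs
∣fromList∣≤length {n} [] = ≤-reflexive (∣⊥∣≡0 n)
∣fromList∣≤length (x ∷ xs) = ≤-trans (∣p∪q∣≤∣p∣+∣q∣ ⁅ x ⁆ (fromList xs))
  (+-mono-≤ (≤-reflexive (∣⁅x⁆∣≡1 x)) (∣fromList∣≤length xs))

∈-fromList⁺ : ∀ {n} {xs : List (Fin n)} {x} → x ∈ˡ xs → x ∈ fromList xs
∈-fromList⁺ (here refl)           = p⊆p∪q _ (x∈⁅x⁆ _)
∈-fromList⁺ {xs = y ∷ xs} (there x∈) = q⊆p∪q ⁅ y ⁆ (fromList xs) (∈-fromList⁺ x∈)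

≢⇒∃-lookup-≢ : ∀ {n} {p q : Subset n} → p ≢ q → ∃[ a ] lookup p a ≢ lookup q a
≢⇒∃-lookup-≢ {p = p} {q} p≢q with any? (λ a → ¬? (lookup p a ≟ᵇ lookup q a))
... | yes found = found
... | no  none  = contradiction
  (trans (sym (tabulate∘lookup p))
    (trans (tabulate-cong λ a →
      decidable-stable (lookup p a ≟ᵇ lookup q a) (λ ne → none (a , ne)))
      (tabulate∘lookup q)))
  p≢q

lookup-∩ : ∀ {n} (p : Subset n) {q a} → a ∈ q → lookup (p ∩ q) a ≡ lookup p a
lookup-∩ p {q} {a} a∈q = trans (lookup-zipWith _∧_ a p q)
  (trans (cong (lookup p a ∧_) ([]=⇒lookup a∈q)) (∧-identityʳ (lookup p a)))

-- Separating families of sets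

module _ {k n} (f : Fin k → Subset n) where

  -- Equality of the traces of `f i` and `f j` on `A`, taken pointwise.
  Agree : List (Fin n) → Fin k → Fin k → Set
  Agree A i j = All (λ a → lookup (f i) a ≡ lookup (f j) a) A

  SeparatesOutside : List (Fin k) → List (Fin n) → Set
  SeparatesOutside D A = ∀ {i j} → i ∉ˡ D → j ∉ˡ D → i ≢ j → ¬ Agree A i j

  -- Induction on `D`: each index is taken out of `D` at the cost of at most one new element. For
  -- empty `A` and a `D` that lists all indices but one, this is Bondy's theorem.
  extend-separating : Injective _≡_ _≡_ f → ∀ D A → SeparatesOutside D A →
    ∃[ A′ ] (length A′ ≤ length A + length D × SeparatesOutside [] A′)
  extend-separating f-inj [] A sep = A , ≤-reflexive (sym (+-identityʳ _)) , sep
  extend-separating f-inj (x ∷ D) A sep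
    with any? (λ y → ¬? (mem? _≟_ y D) ×-dec ¬? (x ≟ y) ×-dec
                     All.all? (λ a → lookup (f x) a ≟ᵇ lookup (f y) a) A)
  -- Here `A` already separates `x` from every index outside `D`, so nothing is added.
  ... | no none = weaken (extend-separating f-inj D A sep′)
    where
    weaken : ∃[ A′ ] (length A′ ≤ length A + length D × SeparatesOutside [] A′) →
             ∃[ A′ ] (length A′ ≤ length A + suc (length D) × SeparatesOutside [] A′)
    weaken (A′ , le , s) =
      A′ , ≤-trans (m≤n⇒m≤1+n le) (≤-reflexive (sym (+-suc _ _))) , s

    sep′ : SeparatesOutside D A
    sep′ {i} {j} i∉D j∉D i≢j ag with x ≟ i | x ≟ j
    ... | yes refl | _        = none (j , j∉D , i≢j , ag)
    ... | no _     | yes refl = none (i , i∉D , i≢j ∘ sym , All.map sym ag)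
    ... | no x≢i   | no x≢j   =
      sep (∉-∷ x≢i i∉D) (∉-∷ x≢j j∉D) i≢j ag
  -- The index y is the only one outside x ∷ D that A fails to separate from x,
  -- so a single element separating x from y is enough.
  ... | yes (y , y∉D , x≢y , x~y) = widen (extend-separating f-inj D (a ∷ A) sep′)
    where
    separator : ∃[ a ] lookup (f x) a ≢ lookup (f y) a
    separator = ≢⇒∃-lookup-≢ (x≢y ∘ f-inj)

    a : Fin n
    a = proj₁ separator

    widen : ∃[ A′ ] (length A′ ≤ suc (length A) + length D × SeparatesOutside [] A′) →
            ∃[ A′ ] (length A′ ≤ length A + suc (length D) × SeparatesOutside [] A′)
    widen (A′ , le , s) = A′ , ≤-trans le (≤-reflexive (sym (+-suc _ _))) , s

    x-sep : ∀ {j} → j ∉ˡ D → x ≢ j → ¬ Agree (a ∷ A) x j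
    x-sep {j} j∉D x≢j (eqₐ ∷ x~j) with y ≟ j
    ... | yes refl = proj₂ separator eqₐ
    -- If `x` agreed on `A` with both `y` and `j`, then `y` and `j` would agree there, although both
    -- lie outside `x ∷ D`.
    ... | no  y≢j  = sep (∉-∷ x≢y y∉D) (∉-∷ x≢j j∉D) y≢j
      (All.zipWith (λ (e , e′) → trans (sym e) e′) (x~y , x~j))

    sep′ : SeparatesOutside D (a ∷ A)
    sep′ {i} {j} i∉D j∉D i≢j ag with x ≟ i | x ≟ j
    ... | yes refl | _        = x-sep j∉D i≢j ag
    ... | no _     | yes refl = x-sep i∉D (i≢j ∘ sym) (All.map sym ag)
    ... | no x≢i   | no x≢j   = sep (∉-∷ x≢i i∉D) (∉-∷ x≢j j∉D) i≢j (All.tail ag)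

-- Closed neighborhoods and identifying codes

∈N⁺ : ∀ {n} (G : Graph n) {x y} → y ≡ x ⊎ Adj G x y → y ∈ N[_] G x
∈N⁺ G {x} {y} p = lookup⇒[]= y _
  (trans (lookup∘tabulate _ y) (dec-true ((y ≟ x) ⊎-dec adj? G x y) p))

∈N⁻ : ∀ {n} (G : Graph n) {x y} → y ∈ N[_] G x → y ≡ x ⊎ Adj G x y
∈N⁻ G {x} {y} y∈ = decidable-stable y∈N? λ y∉ → contradiction
  (trans (sym (dec-false y∈N? y∉)) (trans (sym (lookup∘tabulate _ y)) ([]=⇒lookup y∈)))
  λ ()
  where
  y∈N? : Dec (y ≡ x ⊎ Adj G x y)
  y∈N? = (y ≟ x) ⊎-dec adj? G x y

-- The additional set ∅ makes domination a special case of separation.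
N∪∅ : ∀ {n} → Graph n → Fin (suc n) → Subset n
N∪∅ G zero    = ⊥
N∪∅ G (suc x) = N[_] G x

-- Twin-freeness distinguishes the neighborhoods from each other; membership of `x` in its own
-- closed neighborhood distinguishes them from ∅.
N∪∅-injective : ∀ {n} (G : Graph n) → TwinFree G → Injective _≡_ _≡_ (N∪∅ G)
N∪∅-injective G tf {zero}  {zero}  eq = refl
N∪∅-injective G tf {zero}  {suc y} eq =
  contradiction (subst (y ∈_) (sym eq) (∈N⁺ G (inj₁ refl))) ∉⊥
N∪∅-injective G tf {suc x} {zero}  eq =
  contradiction (subst (x ∈_) eq (∈N⁺ G (inj₁ refl))) ∉⊥
N∪∅-injective G tf {suc x} {suc y} eq with x ≟ y
... | yes x≡y = cong suc x≡y
... | no  x≢y = contradiction (x≢y , eq) (tf x y)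

separating⇒IDCode : ∀ {n} (G : Graph n) A →
  SeparatesOutside (N∪∅ G) [] A → IsIDCode G (fromList A)
separating⇒IDCode G A sep = dominating , separating
  where
  dominating : ∀ x → Nonempty (N[_] G x ∩ fromList A)
  dominating x with any? (λ a → a ∈ˢ? (N[_] G x ∩ fromList A))
  ... | yes ne = ne
  -- An undominated `x` would have a neighborhood that agrees with ∅ on `A`.
  ... | no none = contradiction
    (All.tabulate λ {a} a∈A → trans (lookup-replicate a outside)
      (sym (outside-N a∈A)))
    (sep {zero} {suc x} (λ ()) (λ ()) λ ())
    where
    outside-N : ∀ {a} → a ∈ˡ A → lookup (N[_] G x) a ≡ outside
    outside-N {a} a∈A with lookup (N[_] G x) a in eq
    ... | false = refl
    ... | true  = contradiction
      (a , x∈p∩q⁺ (lookup⇒[]= a _ eq , ∈-fromList⁺ a∈A)) none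

  separating : ∀ x y → x ≢ y → N[_] G x ∩ fromList A ≢ N[_] G y ∩ fromList A
  separating x y x≢y eq = sep {suc x} {suc y} (λ ()) (λ ()) (x≢y ∘ suc-injective)
    (All.tabulate λ {a} a∈A →
      trans (sym (lookup-∩ (N[_] G x) (∈-fromList⁺ a∈A)))
        (trans (cong (λ p → lookup p a) eq) (lookup-∩ (N[_] G y) (∈-fromList⁺ a∈A))))

γᴵᴰ≤length+length : ∀ {n} (G : Graph n) (tf : TwinFree G) D A →
  SeparatesOutside (N∪∅ G) D A →
  γᴵᴰ G (twinFree⇒hasIDCode G tf) ≤ length A + length D
γᴵᴰ≤length+length G tf D A sep
  with extend-separating (N∪∅ G) (N∪∅-injective G tf) D A sep
... | A′ , le , sep′ = ≤-trans
  (proj₂ (γᴵᴰ-isMinCard G (twinFree⇒hasIDCode G tf)) _ (separating⇒IDCode G A′ sep′))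
  (≤-trans (∣fromList∣≤length A′) le)

-- Slices of the product

module _ {m n} (G : Graph m) (H : Graph n) where

  π₁ : Fin (m * n) → Fin m
  π₁ v = proj₁ (remQuot {m} n v)

  π₂ : Fin (m * n) → Fin n
  π₂ v = proj₂ (remQuot {m} n v)

  Slice : Fin n → U.Pred (Fin (m * n)) 0ℓ
  Slice h v = π₂ v ∈ N[_] H h

  -- The adjacency of `G □ H` on decoded pairs, named to serve as the motive when `subst` rewrites
  -- along `remQuot-combine`.
  BoxAdj : Rel (Fin m × Fin n) 0ℓ
  BoxAdj (g , h) (g′ , h′) = (g ≡ g′ × Adj H h h′) ⊎ (Adj G g g′ × h ≡ h′)

  -- The neighborhood is a cross. Its centre is counted with the layer of `h`, so the second
  -- alternative holds only strictly off that layer.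
  ∈N□⁻ : ∀ {x h v} → v ∈ N[_] (G □ H) (combine x h) →
    (π₂ v ≡ h × π₁ v ∈ N[_] G x) ⊎ (π₁ v ≡ x × Adj H h (π₂ v))
  ∈N□⁻ {x} {h} {v} v∈ with ∈N⁻ (G □ H) v∈
  ... | inj₁ refl = inj₁ ( cong proj₂ (remQuot-combine x h)
                         , ∈N⁺ G (inj₁ (cong proj₁ (remQuot-combine x h))))
  ... | inj₂ adj with subst (λ p → BoxAdj p (remQuot n v)) (remQuot-combine x h) adj
  ...   | inj₁ (x≡ , h~) = inj₂ (sym x≡ , h~)
  ...   | inj₂ (x~ , h≡) = inj₁ (sym h≡ , ∈N⁺ G (inj₂ x~))

  ∈N□⁺ : ∀ {x h v} → π₂ v ≡ h → π₁ v ∈ N[_] G x → v ∈ N[_] (G □ H) (combine x h)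
  ∈N□⁺ {x} {h} {v} h≡ x∈ with ∈N⁻ G x∈
  ... | inj₁ x≡ = ∈N⁺ (G □ H) (inj₁
    (trans (sym (combine-remQuot {m} n v)) (cong₂ combine x≡ h≡)))
  ... | inj₂ x~ = ∈N⁺ (G □ H) (inj₂
    (subst (λ p → BoxAdj p (remQuot n v)) (sym (remQuot-combine x h))
      (inj₂ (x~ , sym h≡))))

  slice-bound : (tf : TwinFree G) {C : Subset (m * n)} → IsIDCode (G □ H) C →
    ∀ {h} vs → (∀ {v} → v ∈ C × Slice h v → v ∈ˡ vs) →
    γᴵᴰ G (twinFree⇒hasIDCode G tf) ≤ length vs
  slice-bound tf {C} (dominating , separating) {h} vs cov = ≤-trans
    (γᴵᴰ≤length+length G tf D A sep)
    (≤-reflexive (trans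
      (cong₂ _+_ (length-map π₁ layer) (length-map (suc ∘ π₁) rest))
      (length-filter-¬filter layer? vs)))
    where
    layer? : ∀ v → Dec (π₂ v ≡ h)
    layer? v = π₂ v ≟ h

    layer rest : List (Fin (m * n))
    layer = filter layer? vs
    rest  = filter (¬? ∘ layer?) vs

    A : List (Fin m)
    A = map π₁ layer

    -- The shift by `suc` keeps `zero`, the index of ∅, outside `D`.
    D : List (Fin (suc m))
    D = map (suc ∘ π₁) rest

    -- A code neighbor of `(x , h)` off the layer has first coordinate `x` and lies in the slice,
    -- hence in `rest`, which would put `suc x` into `D`.
    local : ∀ {x v} → suc x ∉ˡ D → v ∈ N[_] (G □ H) (combine x h) → v ∈ C →
            π₂ v ≡ h × π₁ v ∈ N[_] G x × π₁ v ∈ˡ A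
    local {x} {v} x∉D v∈N v∈C with ∈N□⁻ v∈N
    ... | inj₁ (h≡ , x∈) = h≡ , x∈ , ∈-map⁺ π₁
      (∈-filter⁺ layer? (cov (v∈C , ∈N⁺ H (inj₁ h≡))) h≡)
    ... | inj₂ (refl , h~) = contradiction
      (∈-map⁺ (suc ∘ π₁) (∈-filter⁺ (¬? ∘ layer?) (cov (v∈C , ∈N⁺ H (inj₂ h~)))
        λ h≡ → loopless H h (subst (Adj H h) h≡ h~)))
      x∉D

    -- By `local` the first coordinate of `v` is in `A`, where the two sets agree. The index `i` is
    -- left general to serve twice: `zero` contradicts domination, `suc y` yields the inclusion of
    -- traces.
    agree-⊆ : ∀ {x i} → suc x ∉ˡ D → Agree (N∪∅ G) A (suc x) i →
      ∀ {v} → v ∈ N[_] (G □ H) (combine x h) ∩ C → π₂ v ≡ h × π₁ v ∈ N∪∅ G i × v ∈ C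
    agree-⊆ x∉D ag v∈ with x∈p∩q⁻ _ C v∈
    ... | v∈N , v∈C with local x∉D v∈N v∈C
    ...   | h≡ , x∈ , a∈A =
      h≡ , lookup⇒[]= _ _ (trans (sym (All.lookup ag a∈A)) ([]=⇒lookup x∈)) , v∈C

    ¬agree-∅ : ∀ {x} → suc x ∉ˡ D → ¬ Agree (N∪∅ G) A (suc x) zero
    ¬agree-∅ {x} x∉D ag with dominating (combine x h)
    ... | v , v∈ = ∉⊥ (proj₁ (proj₂ (agree-⊆ {i = zero} x∉D ag v∈)))

    trace-⊆ : ∀ {x y} → suc x ∉ˡ D → Agree (N∪∅ G) A (suc x) (suc y) →
      N[_] (G □ H) (combine x h) ∩ C ⊆ N[_] (G □ H) (combine y h) ∩ C
    trace-⊆ {y = y} x∉D ag v∈ with agree-⊆ {i = suc y} x∉D ag v∈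
    ... | h≡ , y∈ , v∈C = x∈p∩q⁺ (∈N□⁺ h≡ y∈ , v∈C)

    sep : SeparatesOutside (N∪∅ G) D A
    sep {zero}  {zero}  _   _   0≢0 _  = 0≢0 refl
    sep {zero}  {suc y} _   y∉D _   ag = ¬agree-∅ y∉D (All.map sym ag)
    sep {suc x} {zero}  x∉D _   _   ag = ¬agree-∅ x∉D ag
    sep {suc x} {suc y} x∉D y∉D x≢y ag =
      separating (combine x h) (combine y h)
        (x≢y ∘ cong suc ∘ proj₁ ∘ combine-injective x h y h)
        (⊆-antisym (trace-⊆ x∉D ag) (trace-⊆ y∉D (All.map sym ag)))

-- A common vertex `w` would give a walk of length at most 2 from `h` to `h′` through `w`.
N-disjoint : ∀ {n} (H : Graph n) {h h′} → DistanceAtLeast H 3 h h′ →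
  ∀ {w} → w ∈ N[_] H h → w ∉ N[_] H h′
N-disjoint H far w∈ w∈′ with ∈N⁻ H w∈ | ∈N⁻ H w∈′
... | inj₁ refl | inj₁ refl = contradiction (far 0 []) λ ()
... | inj₁ refl | inj₂ h′~w = contradiction (far 1 (adj-sym H h′~w ∷ [])) λ { (s≤s ()) }
... | inj₂ h~w  | inj₁ refl = contradiction (far 1 (h~w ∷ [])) λ { (s≤s ()) }
... | inj₂ h~w  | inj₂ h′~w =
  contradiction (far 2 (h~w ∷ adj-sym H h′~w ∷ [])) λ { (s≤s (s≤s ())) }

theorem10 : ∀ {m n : ℕ} (G : Graph m) (H : Graph n)
    (G-twinFree : TwinFree G) (G□H-hasIDCode : HasIDCode (G □ H)) →
    γᴵᴰ (G □ H) G□H-hasIDCode ≥ γᴵᴰ G (twinFree⇒hasIDCode G G-twinFree) * ρ₂ H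
theorem10 G H tf c
  with γᴵᴰ-isMinCard (G □ H) c | ρ₂-isMaxCard H
... | (C , code , ∣C∣≡) , _ | (S , packing , ∣S∣≡) , _ =
  -- Both cardinalities become lengths of lists, so that the slices indexed by `S` can be counted
  -- inside the list of `C`.
  subst₂ (λ s k → γ * s ≤ k)
    (trans (length-elements S) ∣S∣≡) (trans (length-elements C) ∣C∣≡)
    (disjoint-covers⇒*≤length
      {Q = λ h v → v ∈ C × Slice G H h v}
      (λ h v → (v ∈ˢ? C) ×-dec (π₂ G H v ∈ˢ? N[_] H h))
      (elements-unique S)
      (λ h∈ h′∈ h≢h′ (_ , w∈) (_ , w∈′) → N-disjoint H
        (packing _ _ (∈-elements⁻ S h∈) (∈-elements⁻ S h′∈) h≢h′) w∈ w∈′)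
      (slice-bound G H tf code)
      (λ _ (v∈C , _) → ∈-elements⁺ v∈C))
  where
  γ : ℕ
  γ = γᴵᴰ G (twinFree⇒hasIDCode G tf)
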